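{- Let $t\ge 1$ and $r$ be integers with $t<r\le t^2+3t-1$. If $\mathcal H$ is a strictly $t$-intersecting $r$-uniform $r$-partite hypergraph, then $\tau(\mathcal H)\le r-t$.
   Context: All hypergraphs are finite. An $r$-uniform hypergraph $\mathcal H$ is $r$-partite if its vertex set can be partitioned as $V(\mathcal H)=P_1\sqcup\dots\sqcup P_r$ such that $|e\cap P_j|=1$ for every edge $e$ and every $j\in[r]$. It is strictly $t$-intersecting if any two distinct edges share exactly $t$ vertices. A cover of $\mathcal H$ is a set $C\subseteq V(\mathcal H)$ with $C\cap e\neq\emptyset$ for every edge $e$; $\tau(\mathcal H)$ is the minimum size of a cover. -}

module Defs where

open import Data.Nat using (ℕ; _≤_; _∸_)
open import Data.Fin using (Fin; _≟_)
open import Data.Fin.Subset using (Subset; _∩_; ∣_∣; Nonempty)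
open import Data.Vec using (tabulate)
open import Data.Product using (Σ; _×_)
open import Relation.Nullary using (¬_; does)
open import Relation.Binary.PropositionalEquality using (_≡_)

record Hypergraph (n : ℕ) : Set where
  field
    m    : ℕ
    edge : Fin m → Subset n
open Hypergraph public

Uniform : ∀ {n} → ℕ → Hypergraph n → Set
Uniform r H = ∀ i → ∣ edge H i ∣ ≡ r

part : ∀ {n r} → (Fin n → Fin r) → Fin r → Subset n
part p j = tabulate (λ v → does (p v ≟ j))

Partite : ∀ {n} → ℕ → Hypergraph n → Set
Partite {n} r H = Σ (Fin n → Fin r) λ p →
  ∀ i j → ∣ edge H i ∩ part p j ∣ ≡ 1

StrictlyIntersecting : ∀ {n} → ℕ → Hypergraph n → Set
StrictlyIntersecting t H =
  ∀ i k → ¬ (i ≡ k) → ∣ edge H i ∩ edge H k ∣ ≡ t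

IsCover : ∀ {n} → Hypergraph n → Subset n → Set
IsCover H C = ∀ i → Nonempty (C ∩ edge H i)

τ≤ : ∀ {n} → Hypergraph n → ℕ → Set
τ≤ {n} H k = Σ (Subset n) λ C → IsCover H C × ∣ C ∣ ≤ k

{-# OPTIONS --safe #-}
module Submission where

open import Defs
open import Data.Nat using (ℕ; _≤_; _<_; _+_; _*_; _∸_)
open import Data.Nat using (zero; suc; z≤n; s≤s; s≤s⁻¹; NonZero; _≤?_)
open import Data.Nat.Properties using (≤-refl; ≤-reflexive; ≤-trans; ≤-total; n≮n; n≤1+n; <⇒≤; +-comm; +-suc; +-mono-≤; +-monoˡ-≤; +-monoʳ-≤; *-comm; *-assoc; *-zeroʳ; *-identityˡ; *-identityʳ; *-cancelˡ-≤; +-cancelˡ-≤; +-cancelˡ-≡; m+n≤o⇒n≤o; m≤m+n; m∸n+n≡m; m<n⇒0<n∸m; m≤n⇒∃[o]m+o≡n; +-*-semiring; module ≤-Reasoning)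
open import Data.Nat.Tactic.RingSolver using (solve-∀)
open import Algebra.Properties.Semiring.Sum +-*-semiring using (sum; sum-cong-≗; ∑-distrib-+; ∑-comm; sum-remove; *-distribˡ-sum; *-distribʳ-sum)
open import Data.Bool using (true; false; _∧_; if_then_else_)
open import Data.Fin using (Fin; zero; suc; fromℕ<; punchIn; punchOut; _≟_)
open import Data.Fin.Patterns using (0F; 1F; 2F)
open import Data.Fin.Properties using (suc-injective; punchInᵢ≢i; punchIn-injective; punchIn-punchOut; all?; ¬∀⟶∃¬)
open import Data.Fin.Subset using (Subset; _∈_; _∉_; _∩_; _∪_; ∁; ⁅_⁆; ⊥; ∣_∣; Nonempty; inside; outside)
open import Data.Fin.Subset.Properties using (_∈?_; nonempty?; anySubset?; x∈p∩q⁺; x∈p∩q⁻; x∈p∪q⁺; x∈⁅x⁆; x∈⁅y⁆⇒x≡y; ∣⁅x⁆∣≡1; ∣⊥∣≡0; x∈p∧x≢y⇒x∈p-y; x∈p⇒∣p-x∣<∣p∣; x∉p⇒x∈∁p; x∈∁p⇒x∉p; ∣p∩q∣≤∣q∣; ∩-idem)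
open import Data.Vec using ([]; _∷_; lookup; here; there)
open import Data.Vec.Properties using ([]=⇒lookup; lookup⇒[]=; lookup∘tabulate; lookup-zipWith)
open import Data.Vec.Functional using () renaming ([] to []ᶠ; _∷_ to _∷ᶠ_)
open import Data.Product using (∃; _×_; _,_; proj₁; proj₂)
open import Data.Sum using (inj₁; inj₂; [_,_]′)
open import Data.Empty using (⊥-elim) renaming (⊥ to Absurd)
open import Function using (_∘_)
open import Function.Definitions using (Injective)
open import Relation.Nullary using (Dec; ¬_; yes; no; does; contradiction)
open import Relation.Nullary.Decidable using (_×-dec_; dec-true; decidable-stable; from-no)
open import Relation.Binary.PropositionalEquality using (_≡_; _≢_; refl; sym; trans; cong; cong₂; subst; module ≡-Reasoning)

-- Put s = r − t and suppose that no s vertices cover H. Deleting any t vertices S from an edge e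
-- leaves s vertices, which do not form a cover, so some edge meets e exactly in S. Hence every
-- vertex of an edge lies on at least two edges, and on at least s + 1 edges when t ≥ 2.
-- On the other hand, take k edges through v and l edges through w, where v ≠ w lie in the same
-- part, and let x = Σ_F l·1_F − Σ_G k·1_G. Because all pairwise intersections have size t and the
-- coefficients sum to 0, |x|² = k l s (k + l), while x has entries k l and −k l at v and w. So
-- 2 k l ≤ s (k + l), which is impossible for k = l = s + 1. For t = 1 and r = 3 (s = 2), it shows
-- that no vertex lies on three edges, from which a cover by two vertices is obtained.

-- Injective families and cardinalities of subsets.

Inj : ∀ {k n} → (Fin k → Fin n) → Set
Inj γ = Injective _≡_ _≡_ γ

inj-∷ : ∀ {k n} {x : Fin n} {γ : Fin k → Fin n} → (∀ i → x ≢ γ i) → Inj γ → Inj (x ∷ᶠ γ)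
inj-∷ x∉γ γ-inj {zero}  {zero}  _  = refl
inj-∷ x∉γ γ-inj {zero}  {suc j} eq = ⊥-elim (x∉γ j eq)
inj-∷ x∉γ γ-inj {suc i} {zero}  eq = ⊥-elim (x∉γ i (sym eq))
inj-∷ x∉γ γ-inj {suc i} {suc j} eq = cong suc (γ-inj eq)

inj-pair : ∀ {n} {x y : Fin n} → x ≢ y → Inj (x ∷ᶠ y ∷ᶠ []ᶠ)
inj-pair x≢y = inj-∷ (λ { zero → x≢y ; (suc ()) }) (inj-∷ (λ ()) (λ { {()} }))

∀-∷ : ∀ {k n ℓ} {P : Fin n → Set ℓ} {x : Fin n} {γ : Fin k → Fin n} →
      P x → (∀ i → P (γ i)) → ∀ i → P ((x ∷ᶠ γ) i)
∀-∷ px pγ zero    = px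
∀-∷ px pγ (suc i) = pγ i

injective-into⇒≤∣∣ : ∀ {k n} {A : Subset n} (γ : Fin k → Fin n) → Inj γ → (∀ i → γ i ∈ A) → k ≤ ∣ A ∣
injective-into⇒≤∣∣ {zero}  γ γ-inj γ∈A = z≤n
injective-into⇒≤∣∣ {suc k} γ γ-inj γ∈A =
  ≤-trans (s≤s (injective-into⇒≤∣∣ (γ ∘ suc) (suc-injective ∘ γ-inj)
                 (λ i → x∈p∧x≢y⇒x∈p-y (γ∈A (suc i)) (λ eq → case-suc (γ-inj eq)))))
          (x∈p⇒∣p-x∣<∣p∣ (γ∈A zero))
  where
  case-suc : ∀ {i : Fin k} → suc i ≢ zero
  case-suc ()

≤∣∣⇒injective-into : ∀ {k n} (A : Subset n) → k ≤ ∣ A ∣ →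
                     ∃ λ (γ : Fin k → Fin n) → Inj γ × (∀ i → γ i ∈ A)
≤∣∣⇒injective-into {zero}  A             _    = (λ ()) , (λ { {()} }) , (λ ())
≤∣∣⇒injective-into {suc k} (outside ∷ A) k≤ with ≤∣∣⇒injective-into A k≤
... | γ , γ-inj , γ∈A = suc ∘ γ , γ-inj ∘ suc-injective , there ∘ γ∈A
≤∣∣⇒injective-into {suc k} (inside ∷ A)  k≤ with ≤∣∣⇒injective-into A (s≤s⁻¹ k≤)
... | γ , γ-inj , γ∈A =
  zero ∷ᶠ (suc ∘ γ) , inj-∷ (λ _ ()) (γ-inj ∘ suc-injective) ,
  ∀-∷ {P = _∈ (inside ∷ A)} here (there ∘ γ∈A)

0<∣∣⇒Nonempty : ∀ {n} (A : Subset n) → 0 < ∣ A ∣ → Nonempty A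
0<∣∣⇒Nonempty A 0<A with ≤∣∣⇒injective-into A 0<A
... | γ , _ , γ∈A = γ zero , γ∈A zero

∣p∩q∣+∣p∩∁q∣ : ∀ {n} (p q : Subset n) → ∣ p ∩ q ∣ + ∣ p ∩ ∁ q ∣ ≡ ∣ p ∣
∣p∩q∣+∣p∩∁q∣ []            []            = refl
∣p∩q∣+∣p∩∁q∣ (outside ∷ p) (_ ∷ q)       = ∣p∩q∣+∣p∩∁q∣ p q
∣p∩q∣+∣p∩∁q∣ (inside ∷ p)  (inside ∷ q)  = cong suc (∣p∩q∣+∣p∩∁q∣ p q)
∣p∩q∣+∣p∩∁q∣ (inside ∷ p)  (outside ∷ q) = trans (+-suc _ _) (cong suc (∣p∩q∣+∣p∩∁q∣ p q))

∣p∪q∣≤∣p∣+∣q∣ : ∀ {n} (p q : Subset n) → ∣ p ∪ q ∣ ≤ ∣ p ∣ + ∣ q ∣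
∣p∪q∣≤∣p∣+∣q∣ []            []            = z≤n
∣p∪q∣≤∣p∣+∣q∣ (outside ∷ p) (outside ∷ q) = ∣p∪q∣≤∣p∣+∣q∣ p q
∣p∪q∣≤∣p∣+∣q∣ (outside ∷ p) (inside ∷ q)  =
  ≤-trans (s≤s (∣p∪q∣≤∣p∣+∣q∣ p q)) (≤-reflexive (sym (+-suc _ _)))
∣p∪q∣≤∣p∣+∣q∣ (inside ∷ p)  (outside ∷ q) = s≤s (∣p∪q∣≤∣p∣+∣q∣ p q)
∣p∪q∣≤∣p∣+∣q∣ (inside ∷ p)  (inside ∷ q)  =
  s≤s (≤-trans (∣p∪q∣≤∣p∣+∣q∣ p q) (+-monoʳ-≤ ∣ p ∣ (n≤1+n _)))

-- Vertices are chosen as families, whereas covers are subsets; this passes from one to the other.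
image : ∀ {k n} → (Fin k → Fin n) → Subset n
image {zero}  γ = ⊥
image {suc k} γ = ⁅ γ zero ⁆ ∪ image (γ ∘ suc)

∈-image : ∀ {k n} (γ : Fin k → Fin n) i → γ i ∈ image γ
∈-image γ zero    = x∈p∪q⁺ (inj₁ (x∈⁅x⁆ _))
∈-image γ (suc i) = x∈p∪q⁺ (inj₂ (∈-image (γ ∘ suc) i))

∣image∣≤ : ∀ {k n} (γ : Fin k → Fin n) → ∣ image γ ∣ ≤ k
∣image∣≤ {zero}  {n} γ = ≤-reflexive (∣⊥∣≡0 n)
∣image∣≤ {suc k} γ = ≤-trans (∣p∪q∣≤∣p∣+∣q∣ ⁅ γ zero ⁆ _)
  (+-mono-≤ (≤-reflexive (∣⁅x⁆∣≡1 (γ zero))) (∣image∣≤ (γ ∘ suc)))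

-- Indicator functions and finite sums.

χ : ∀ {n} → Subset n → Fin n → ℕ
χ p u = if lookup p u then 1 else 0

χ-∈ : ∀ {n} {p : Subset n} {u} → u ∈ p → χ p u ≡ 1
χ-∈ u∈p = cong (if_then 1 else 0) ([]=⇒lookup u∈p)

χ-∉ : ∀ {n} {p : Subset n} {u} → u ∉ p → χ p u ≡ 0
χ-∉ {p = p} {u} u∉p with lookup p u in eq
... | true  = contradiction (lookup⇒[]= u p eq) u∉p
... | false = refl

χ-∩ : ∀ {n} (p q : Subset n) u → χ (p ∩ q) u ≡ χ p u * χ q u
χ-∩ p q u rewrite lookup-zipWith _∧_ u p q with lookup p u
... | true  = sym (*-identityˡ _)
... | false = refl

∑χ≡∣∣ : ∀ {n} (p : Subset n) → sum (χ p) ≡ ∣ p ∣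
∑χ≡∣∣ []            = refl
∑χ≡∣∣ (outside ∷ p) = ∑χ≡∣∣ p
∑χ≡∣∣ (inside ∷ p)  = cong suc (∑χ≡∣∣ p)

sum-const : ∀ {k c} {f : Fin k → ℕ} → (∀ i → f i ≡ c) → sum f ≡ k * c
sum-const {zero}  f≡c = refl
sum-const {suc k} f≡c = cong₂ _+_ (f≡c zero) (sum-const (f≡c ∘ suc))

-- The shape of a row of the Gram matrix of a family of edges: `a + c` on the diagonal, `c`
-- elsewhere.
sum-const-except : ∀ {k a c} {f : Fin k → ℕ} i → f i ≡ a + c → (∀ j → i ≢ j → f j ≡ c) →
                   sum f ≡ a + k * c
sum-const-except {suc k} {a} {c} {f} i fi f≢ = begin
  sum f                          ≡⟨ sum-remove {i = i} f ⟩
  f i + sum (f ∘ punchIn i)      ≡⟨ cong₂ _+_ fi (sum-const (λ j → f≢ (punchIn i j) (punchInᵢ≢i i j ∘ sym))) ⟩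
  (a + c) + k * c                ≡⟨ lemma a c (k * c) ⟩
  a + (c + k * c)                ∎
  where
  open ≡-Reasoning
  lemma : ∀ a c x → (a + c) + x ≡ a + (c + x)
  lemma = solve-∀

sum-mono-≤ : ∀ {k} {f g : Fin k → ℕ} → (∀ i → f i ≤ g i) → sum f ≤ sum g
sum-mono-≤ {zero}  f≤g = z≤n
sum-mono-≤ {suc k} f≤g = +-mono-≤ (f≤g zero) (sum-mono-≤ (f≤g ∘ suc))

-- This is `(x − y)² ≥ 0` without subtraction: for `y = x + d` the two sides differ by `d²`.
2xy≤x²+y² : ∀ x y → 2 * (x * y) ≤ x * x + y * y
2xy≤x²+y² x y = [ ordered x y , (λ y≤x → reordered (ordered y x y≤x)) ]′ (≤-total x y)
  where
  square : ∀ x d → 2 * (x * (x + d)) + d * d ≡ x * x + (x + d) * (x + d)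
  square = solve-∀
  ordered : ∀ x y → x ≤ y → 2 * (x * y) ≤ x * x + y * y
  ordered x y x≤y with m≤n⇒∃[o]m+o≡n x≤y
  ... | d , refl = ≤-trans (m≤m+n _ (d * d)) (≤-reflexive (square x d))
  reordered : 2 * (y * x) ≤ y * y + x * x → 2 * (x * y) ≤ x * x + y * y
  reordered h rewrite *-comm x y | +-comm (x * x) (y * y) = h

-- Degree vectors and their inner products.

degree : ∀ {k n} → (Fin k → Subset n) → Fin n → ℕ
degree F u = sum (λ i → χ (F i) u)

degree-∈ : ∀ {k n} (F : Fin k → Subset n) {u} → (∀ i → u ∈ F i) → degree F u ≡ k
degree-∈ F u∈F = trans (sum-const (λ i → χ-∈ (u∈F i))) (*-identityʳ _)

degree-∉ : ∀ {k n} (F : Fin k → Subset n) {u} → (∀ i → u ∉ F i) → degree F u ≡ 0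
degree-∉ {k} F u∉F = trans (sum-const (λ i → χ-∉ (u∉F i))) (*-zeroʳ k)

-- Bilinear expansion of the inner product of two sums of indicator vectors.
∑degree*degree : ∀ {k l n} (F : Fin k → Subset n) (G : Fin l → Subset n) →
  sum (λ u → degree F u * degree G u) ≡ sum (λ i → sum (λ j → ∣ F i ∩ G j ∣))
∑degree*degree F G = begin
  sum (λ u → degree F u * degree G u)
    ≡⟨ sum-cong-≗ (λ u → *-distribʳ-sum (degree G u) (λ i → χ (F i) u)) ⟩
  sum (λ u → sum (λ i → χ (F i) u * degree G u))
    ≡⟨ ∑-comm (λ u i → χ (F i) u * degree G u) ⟩
  sum (λ i → sum (λ u → χ (F i) u * degree G u))
    ≡⟨ sum-cong-≗ (λ i → sum-cong-≗ (λ u → *-distribˡ-sum (χ (F i) u) (λ j → χ (G j) u))) ⟩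
  sum (λ i → sum (λ u → sum (λ j → χ (F i) u * χ (G j) u)))
    ≡⟨ sum-cong-≗ (λ i → ∑-comm (λ u j → χ (F i) u * χ (G j) u)) ⟩
  sum (λ i → sum (λ j → sum (λ u → χ (F i) u * χ (G j) u)))
    ≡⟨ sum-cong-≗ (λ i → sum-cong-≗ (λ j → trans (sum-cong-≗ (λ u → sym (χ-∩ (F i) (G j) u))) (∑χ≡∣∣ (F i ∩ G j)))) ⟩
  sum (λ i → sum (λ j → ∣ F i ∩ G j ∣)) ∎
  where open ≡-Reasoning

-- Each of the `k` rows of the Gram matrix sums to `(s + t) + (k − 1) t = s + k t`.
∑degree² : ∀ {k n s t} (F : Fin k → Subset n) → (∀ i → ∣ F i ∣ ≡ s + t) →
  (∀ i j → i ≢ j → ∣ F i ∩ F j ∣ ≡ t) → sum (λ u → degree F u * degree F u) ≡ k * (s + k * t)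
∑degree² F ∣F∣ ∣F∩F∣ = trans (∑degree*degree F F)
  (sum-const (λ i → sum-const-except i (trans (cong ∣_∣ (∩-idem (F i))) (∣F∣ i)) (∣F∩F∣ i)))

-- Obtained from Σᵤ (l · deg_F u − k · deg_G u)² by keeping only the terms u = v and u = w,
-- each equal to (k l)²; the subtraction is moved to the other side of the inequality.
two-stars : ∀ {k l n s t} (F : Fin k → Subset n) (G : Fin l → Subset n) {v w : Fin n} →
  .{{NonZero k}} → .{{NonZero l}} →
  (∀ i → ∣ F i ∣ ≡ s + t) → (∀ i j → i ≢ j → ∣ F i ∩ F j ∣ ≡ t) →
  (∀ i → ∣ G i ∣ ≡ s + t) → (∀ i j → i ≢ j → ∣ G i ∩ G j ∣ ≡ t) →
  (∀ i j → ∣ F i ∩ G j ∣ ≡ t) →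
  (∀ i → v ∈ F i) → (∀ j → v ∉ G j) → (∀ i → w ∉ F i) → (∀ j → w ∈ G j) →
  2 * (k * l) ≤ s * (k + l)
two-stars {k@(suc _)} {l@(suc _)} {n} {s} {t} F G {v} {w} ∣F∣ ∣F∩F∣ ∣G∣ ∣G∩G∣ ∣F∩G∣ v∈F v∉G w∉F w∈G =
  -- The claim is multiplied by `k l`, and the cross term `2 k² l² t` is added to both sides.
  *-cancelˡ-≤ (k * l) (+-cancelˡ-≤ (2 * (l * k * (k * (l * t)))) _ _ (begin
    2 * (l * k * (k * (l * t))) + k * l * (2 * (k * l))
      ≡⟨ lhs k l t ⟩
    2 * (l * k) * (k * (l * t)) + k * l * (k * l) * 2
      ≡⟨ cong₂ (λ x y → 2 * (l * k) * x + k * l * (k * l) * y) (sym ∑AB) (sym ∑δ) ⟩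
    2 * (l * k) * sum (λ u → A u * B u) + k * l * (k * l) * sum δ
      ≡⟨ cong₂ _+_ (*-distribˡ-sum (2 * (l * k)) (λ u → A u * B u)) (*-distribˡ-sum (k * l * (k * l)) δ) ⟩
    sum (λ u → 2 * (l * k) * (A u * B u)) + sum (λ u → k * l * (k * l) * δ u)
      ≡⟨ ∑-distrib-+ (λ u → 2 * (l * k) * (A u * B u)) (λ u → k * l * (k * l) * δ u) ⟨
    sum (λ u → 2 * (l * k) * (A u * B u) + k * l * (k * l) * δ u)
      ≤⟨ sum-mono-≤ pointwise ⟩
    sum (λ u → l * l * (A u * A u) + k * k * (B u * B u))
      ≡⟨ ∑-distrib-+ (λ u → l * l * (A u * A u)) (λ u → k * k * (B u * B u)) ⟩
    sum (λ u → l * l * (A u * A u)) + sum (λ u → k * k * (B u * B u))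
      ≡⟨ cong₂ _+_ (*-distribˡ-sum (l * l) (λ u → A u * A u)) (*-distribˡ-sum (k * k) (λ u → B u * B u)) ⟨
    l * l * sum (λ u → A u * A u) + k * k * sum (λ u → B u * B u)
      ≡⟨ cong₂ (λ x y → l * l * x + k * k * y) (∑degree² F ∣F∣ ∣F∩F∣) (∑degree² G ∣G∣ ∣G∩G∣) ⟩
    l * l * (k * (s + k * t)) + k * k * (l * (s + l * t))
      ≡⟨ rhs k l s t ⟩
    2 * (l * k * (k * (l * t))) + k * l * (s * (k + l)) ∎))
  where
  open ≤-Reasoning
  A B δ : Fin n → ℕ
  A = degree F
  B = degree G
  δ u = χ ⁅ v ⁆ u + χ ⁅ w ⁆ u
  v≢w : v ≢ w
  v≢w refl = v∉G zero (w∈G zero)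
  ∑AB : sum (λ u → A u * B u) ≡ k * (l * t)
  ∑AB = trans (∑degree*degree F G) (sum-const (λ i → sum-const (∣F∩G∣ i)))
  ∑δ : sum δ ≡ 2
  ∑δ = trans (∑-distrib-+ (χ ⁅ v ⁆) (χ ⁅ w ⁆))
    (cong₂ _+_ (trans (∑χ≡∣∣ ⁅ v ⁆) (∣⁅x⁆∣≡1 v)) (trans (∑χ≡∣∣ ⁅ w ⁆) (∣⁅x⁆∣≡1 w)))
  lhs : ∀ k l t → 2 * (l * k * (k * (l * t))) + k * l * (2 * (k * l))
                ≡ 2 * (l * k) * (k * (l * t)) + k * l * (k * l) * 2
  lhs = solve-∀
  rhs : ∀ k l s t → l * l * (k * (s + k * t)) + k * k * (l * (s + l * t))
                  ≡ 2 * (l * k * (k * (l * t))) + k * l * (s * (k + l))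
  rhs = solve-∀
  at-v : ∀ k l → 2 * (l * k) * (k * 0) + k * l * (k * l) * (1 + 0) ≡ l * l * (k * k) + k * k * (0 * 0)
  at-v = solve-∀
  at-w : ∀ k l → 2 * (l * k) * (0 * l) + k * l * (k * l) * (0 + 1) ≡ l * l * (0 * 0) + k * k * (l * l)
  at-w = solve-∀
  elsewhereˡ : ∀ k l a b → 2 * (l * k) * (a * b) + k * l * (k * l) * (0 + 0) ≡ 2 * (l * a * (k * b))
  elsewhereˡ = solve-∀
  elsewhereʳ : ∀ k l a b → l * a * (l * a) + k * b * (k * b) ≡ l * l * (a * a) + k * k * (b * b)
  elsewhereʳ = solve-∀
  -- At `v` and at `w` both sides equal `(k l)²`. Elsewhere `δ` vanishes, and `2xy≤x²+y²` applies to
  -- `l * A u` and `k * B u`.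
  pointwise : ∀ u → 2 * (l * k) * (A u * B u) + k * l * (k * l) * δ u
                  ≤ l * l * (A u * A u) + k * k * (B u * B u)
  pointwise u with u ≟ v | u ≟ w
  ... | yes refl | yes refl = contradiction refl v≢w
  ... | yes refl | no _
    rewrite degree-∈ F v∈F | degree-∉ G v∉G | χ-∈ (x∈⁅x⁆ v)
          | χ-∉ (v≢w ∘ x∈⁅y⁆⇒x≡y w) = ≤-reflexive (at-v k l)
  ... | no _ | yes refl
    rewrite degree-∉ F w∉F | degree-∈ G w∈G | χ-∈ (x∈⁅x⁆ w)
          | χ-∉ (v≢w ∘ sym ∘ x∈⁅y⁆⇒x≡y v) = ≤-reflexive (at-w k l)
  ... | no u≢v | no u≢w
    rewrite χ-∉ (u≢v ∘ x∈⁅y⁆⇒x≡y v) | χ-∉ (u≢w ∘ x∈⁅y⁆⇒x≡y w) =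
      ≤-trans (≤-reflexive (elsewhereˡ k l (A u) (B u)))
        (≤-trans (2xy≤x²+y² (l * A u) (k * B u)) (≤-reflexive (elsewhereʳ k l (A u) (B u))))

-- Membership in parts, and decidability of the cover bound.

∈-part : ∀ {n r} (p : Fin n → Fin r) {v j} → p v ≡ j → v ∈ part p j
∈-part p {v} {j} pv≡j = lookup⇒[]= v _ (trans (lookup∘tabulate _ v) (dec-true (p v ≟ j) pv≡j))

∈-part⁻ : ∀ {n r} (p : Fin n → Fin r) {v j} → v ∈ part p j → p v ≡ j
∈-part⁻ p {v} {j} v∈ with p v ≟ j | trans (sym (lookup∘tabulate (λ u → does (p u ≟ j)) v)) ([]=⇒lookup v∈)
... | yes pv≡j | _ = pv≡j
... | no  _    | ()

-- A search through the finitely many subsets; it makes the proof by contradiction constructive.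
τ≤? : ∀ {n} (H : Hypergraph n) k → Dec (τ≤ H k)
τ≤? H k = anySubset? (λ C → all? (λ i → nonempty? (C ∩ edge H i)) ×-dec (∣ C ∣ ≤? k))

-- Hypergraphs without a cover of at most `s` vertices.

module _ {n} (H : Hypergraph n) {r s t} (r≡s+t : r ≡ s + t) (1≤s : 1 ≤ s) (1≤t : 1 ≤ t)
         (uniform : Uniform r H) (partite : Partite r H) (strict : StrictlyIntersecting t H)
         (¬τ≤s : ¬ τ≤ H s) where

  private
    E : Fin (m H) → Subset n
    E = edge H

    p : Fin n → Fin r
    p = proj₁ partite

  _∋_ : Fin (m H) → Fin n → Set
  e ∋ v = v ∈ E e

  Star : ℕ → Fin n → Set
  Star k v = ∃ λ (F : Fin k → Fin (m H)) → Inj F × (∀ i → F i ∋ v)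

  missing-edge : ∀ C → ∣ C ∣ ≤ s → ∃ λ e → ∀ {v} → v ∈ C → v ∉ E e
  missing-edge C ∣C∣≤s
    with ¬∀⟶∃¬ _ _ (λ e → nonempty? (C ∩ E e)) (λ cover → ¬τ≤s (C , cover , ∣C∣≤s))
  ... | e , empty = e , λ v∈C v∈e → empty (_ , x∈p∩q⁺ (v∈C , v∈e))

  missing-vertex : ∀ v → ∃ λ e → v ∉ E e
  missing-vertex v with missing-edge ⁅ v ⁆ (≤-trans (≤-reflexive (∣⁅x⁆∣≡1 v)) 1≤s)
  ... | e , miss = e , miss (x∈⁅x⁆ v)

  in-part : ∀ e j → ∃ λ v → e ∋ v × p v ≡ j
  in-part e j with 0<∣∣⇒Nonempty _ (≤-reflexive (sym (proj₂ partite e j)))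
  ... | v , v∈ with x∈p∩q⁻ (E e) (part p j) v∈
  ... | v∈e , v∈part = v , v∈e , ∈-part⁻ p v∈part

  same-part⇒≡ : ∀ {e v w} → e ∋ v → e ∋ w → p v ≡ p w → v ≡ w
  same-part⇒≡ {e} {v} {w} v∈e w∈e pv≡pw with v ≟ w
  ... | yes v≡w = v≡w
  ... | no  v≢w = contradiction (≤-trans
          (injective-into⇒≤∣∣ {A = E e ∩ part p (p w)} (v ∷ᶠ w ∷ᶠ []ᶠ) (inj-pair v≢w)
            (∀-∷ {P = _∈ (E e ∩ part p (p w))} (x∈p∩q⁺ (v∈e , ∈-part p pv≡pw))
              (∀-∷ {P = _∈ (E e ∩ part p (p w))} (x∈p∩q⁺ (w∈e , ∈-part p refl)) (λ ()))))
          (≤-reflexive (proj₂ partite e (p w)))) (n≮n 1)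

  -- The edges may coincide, so this also supplies a vertex of a single edge.
  intersect : ∀ e f → ∃ λ v → e ∋ v × f ∋ v
  intersect e f with e ≟ f
  ... | yes refl
    with 0<∣∣⇒Nonempty (E e) (≤-trans 1≤t (m+n≤o⇒n≤o s (≤-reflexive (trans (sym r≡s+t) (sym (uniform e))))))
  ...   | v , v∈ = v , v∈ , v∈
  intersect e f | no e≢f with 0<∣∣⇒Nonempty (E e ∩ E f) (≤-trans 1≤t (≤-reflexive (sym (strict e f e≢f))))
  ...   | v , v∈ = v , x∈p∩q⁻ (E e) (E f) v∈

  ∣e∩∁f∣≡s : ∀ {e f} → e ≢ f → ∣ E e ∩ ∁ (E f) ∣ ≡ s
  ∣e∩∁f∣≡s {e} {f} e≢f = +-cancelˡ-≡ t _ _ (begin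
    t + ∣ E e ∩ ∁ (E f) ∣              ≡⟨ cong (_+ ∣ E e ∩ ∁ (E f) ∣) (strict e f e≢f) ⟨
    ∣ E e ∩ E f ∣ + ∣ E e ∩ ∁ (E f) ∣  ≡⟨ ∣p∩q∣+∣p∩∁q∣ (E e) (E f) ⟩
    ∣ E e ∣                            ≡⟨ uniform e ⟩
    r                                  ≡⟨ r≡s+t ⟩
    s + t                              ≡⟨ +-comm s t ⟩
    t + s                              ∎)
    where open ≡-Reasoning

  -- The t vertices of e outside γ form a set of the form e ∩ f, as otherwise γ would be a cover.
  complementary-edge : ∀ e (γ : Fin s → Fin n) → Inj γ → (∀ i → e ∋ γ i) →
    ∃ λ f → e ≢ f × (∀ i → γ i ∉ E f) × (∀ {v} → e ∋ v → (∀ i → v ≢ γ i) → f ∋ v)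
  complementary-edge e γ γ-inj γ∈e with missing-edge (image γ) (∣image∣≤ γ)
  ... | f , miss = f , e≢f , γ∉f , contains
    where
    γ∉f : ∀ i → γ i ∉ E f
    γ∉f i = miss (∈-image γ i)
    e≢f : e ≢ f
    -- Since `1 ≤ s`, `γ` has a first vertex; it lies in `e` but not in `f`.
    e≢f refl = γ∉f (fromℕ< 1≤s) (γ∈e (fromℕ< 1≤s))
    contains : ∀ {v} → e ∋ v → (∀ i → v ≢ γ i) → f ∋ v
    contains {v} v∈e v∉γ with v ∈? E f
    ... | yes v∈f = v∈f
    -- Otherwise `v` and `γ` would be `s + 1` vertices of `e` outside `f`, where there are only `s`.
    ... | no  v∉f = contradiction
            (≤-trans (injective-into⇒≤∣∣ {A = E e ∩ ∁ (E f)} (v ∷ᶠ γ) (inj-∷ v∉γ γ-inj)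
              (∀-∷ {P = _∈ (E e ∩ ∁ (E f))} (x∈p∩q⁺ (v∈e , x∉p⇒x∈∁p v∉f))
                (λ i → x∈p∩q⁺ (γ∈e i , x∉p⇒x∈∁p (γ∉f i)))))
              (≤-reflexive (∣e∩∁f∣≡s e≢f)))
            (n≮n s)

  -- Serves to choose vertices for deletion while keeping `v`: at least `r − 1 ≥ k` vertices of `e`
  -- differ from `v`.
  avoiding : ∀ {k} e v → k < r →
    ∃ λ (γ : Fin k → Fin n) → Inj γ × (∀ i → e ∋ γ i) × (∀ i → v ≢ γ i)
  avoiding {k} e v k<r with ≤∣∣⇒injective-into (E e ∩ ∁ ⁅ v ⁆) (s≤s⁻¹ (begin
    suc k                                    ≤⟨ k<r ⟩
    r                                        ≡⟨ uniform e ⟨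
    ∣ E e ∣                                  ≡⟨ ∣p∩q∣+∣p∩∁q∣ (E e) ⁅ v ⁆ ⟨
    ∣ E e ∩ ⁅ v ⁆ ∣ + ∣ E e ∩ ∁ ⁅ v ⁆ ∣      ≤⟨ +-monoˡ-≤ _ (∣p∩q∣≤∣q∣ (E e) ⁅ v ⁆) ⟩
    ∣ ⁅ v ⁆ ∣ + ∣ E e ∩ ∁ ⁅ v ⁆ ∣            ≡⟨ cong (_+ ∣ E e ∩ ∁ ⁅ v ⁆ ∣) (∣⁅x⁆∣≡1 v) ⟩
    suc ∣ E e ∩ ∁ ⁅ v ⁆ ∣                    ∎))
    where open ≤-Reasoning
  ... | γ , γ-inj , γ∈ = γ , γ-inj , proj₁ ∘ split , λ { i refl → x∈∁p⇒x∉p (proj₂ (split i)) (x∈⁅x⁆ v) }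
    where
    split : ∀ i → e ∋ γ i × γ i ∈ ∁ ⁅ v ⁆
    split i = x∈p∩q⁻ (E e) (∁ ⁅ v ⁆) (γ∈ i)

  -- An edge meets the common part of `v` and `w` only once, so no edge contains both. Hence the
  -- stars share no edge, and strict intersection applies across them.
  stars⇒≤ : ∀ {k l v w} .{{_ : NonZero k}} .{{_ : NonZero l}} →
    v ≢ w → p v ≡ p w → Star k v → Star l w → 2 * (k * l) ≤ s * (k + l)
  stars⇒≤ {v = v} {w} v≢w pv≡pw (F , F-inj , v∈F) (G , G-inj , w∈G) =
    two-stars (E ∘ F) (E ∘ G)
      (∣E∣ ∘ F) (λ i j i≢j → strict _ _ (i≢j ∘ F-inj))
      (∣E∣ ∘ G) (λ i j i≢j → strict _ _ (i≢j ∘ G-inj))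
      (λ i j → strict _ _ (λ eq → v∉ (w∈G j) (subst (_∋ v) eq (v∈F i))))
      v∈F (v∉ ∘ w∈G) (λ i w∈Fi → v∉ w∈Fi (v∈F i)) w∈G
    where
    ∣E∣ : ∀ e → ∣ E e ∣ ≡ s + t
    ∣E∣ e = trans (uniform e) r≡s+t
    v∉ : ∀ {e} → e ∋ w → v ∉ E e
    v∉ w∈e v∈e = v≢w (same-part⇒≡ v∈e w∈e pv≡pw)

  -- As `1 ≤ s`, `v` alone is not a cover; an edge missing `v` meets the part of `v` in another
  -- vertex.
  companion : ∀ v → ∃ λ w → v ≢ w × p v ≡ p w × ∃ λ e → e ∋ w
  companion v with missing-vertex v
  ... | e , v∉e with in-part e (p v)
  ... | w , w∈e , pw≡pv = w , (λ { refl → v∉e w∈e }) , sym pw≡pv , e , w∈e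

  -- Since `s < r`, one can delete `s` vertices of `e` other than `v`; the complementary edge then
  -- contains `v`.
  other-edge : ∀ {e v} → e ∋ v → ∃ λ f → e ≢ f × f ∋ v
  other-edge {e} {v} v∈e with avoiding e v s<r
    where
    s<r : s < r
    s<r = ≤-trans (≤-reflexive (+-comm 1 s)) (≤-trans (+-monoʳ-≤ s 1≤t) (≤-reflexive (sym r≡s+t)))
  ... | γ , γ-inj , γ∈e , v∉γ with complementary-edge e γ γ-inj γ∈e
  ... | f , e≢f , _ , contains = f , e≢f , contains v∈e v∉γ

  2-star : ∀ {e v} → e ∋ v → Star 2 v
  2-star {e} {v} v∈e with other-edge v∈e
  ... | f , e≢f , v∈f = e ∷ᶠ f ∷ᶠ []ᶠ , inj-pair e≢f , ∀-∷ {P = _∋ v} v∈e (∀-∷ {P = _∋ v} v∈f (λ ()))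

  -- With `t ≥ 2` there is room for `s + 1` vertices `β` of `e` other than `v`. Deleting all of them
  -- but `β i` gives an edge `f i` through `v` and `β i` that misses every other `β j`, so these
  -- edges are distinct.
  [1+s]-star : 2 ≤ t → ∀ {e v} → e ∋ v → Star (suc s) v
  [1+s]-star 2≤t {e} {v} v∈e with avoiding e v 1+s<r
    where
    1+s<r : suc s < r
    1+s<r = ≤-trans (≤-reflexive (+-comm 2 s)) (≤-trans (+-monoʳ-≤ s 2≤t) (≤-reflexive (sym r≡s+t)))
  ... | β , β-inj , β∈e , v∉β = proj₁ ∘ f , f-inj , (λ i → proj₂ (proj₂ (proj₂ (f i))) v∈e (v∉β ∘ punchIn i))
    where
    f : ∀ i → _
    f i = complementary-edge e (β ∘ punchIn i) (punchIn-injective i _ _ ∘ β-inj) (β∈e ∘ punchIn i)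
    β∈f : ∀ i → proj₁ (f i) ∋ β i
    β∈f i = proj₂ (proj₂ (proj₂ (f i))) (β∈e i) (λ j βi≡ → punchInᵢ≢i i j (sym (β-inj βi≡)))
    f-inj : Inj (proj₁ ∘ f)
    f-inj {i} {j} fi≡fj with i ≟ j
    ... | yes i≡j = i≡j
    ... | no  i≢j = contradiction (subst (_∋ β i) fi≡fj (β∈f i))
            (subst (λ k → β k ∉ E (proj₁ (f j))) (punchIn-punchOut (i≢j ∘ sym))
              (proj₁ (proj₂ (proj₂ (f j))) (punchOut (i≢j ∘ sym))))

  -- Contradictions between large stars and the two-star bound.

  first-edge : Fin (m H)
  first-edge = proj₁ (missing-edge ⊥ (≤-trans (≤-reflexive (∣⊥∣≡0 n)) z≤n))

  -- Stars of equal size `k` at a vertex and its companion give `2 k² ≤ 2 k s`.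
  stars-everywhere⇒≤ : ∀ k → (∀ {e v} → e ∋ v → Star k v) → k ≤ s
  stars-everywhere⇒≤ zero      star = z≤n
  stars-everywhere⇒≤ k@(suc _) star with intersect first-edge first-edge
  ... | v , v∈e , _ with companion v
  ... | w , v≢w , pv≡pw , g , w∈g =
    *-cancelˡ-≤ (2 * k) (begin
      2 * k * k      ≡⟨ *-assoc 2 k k ⟩
      2 * (k * k)    ≤⟨ stars⇒≤ v≢w pv≡pw (star v∈e) (star w∈g) ⟩
      s * (k + k)    ≡⟨ rearranged s k ⟩
      2 * k * s      ∎)
    where
    open ≤-Reasoning
    rearranged : ∀ s k → s * (k + k) ≡ 2 * k * s
    rearranged = solve-∀

  no-3-star : s ≡ 2 → ∀ {v} → ¬ Star 3 v
  no-3-star refl {v} star with companion v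
  -- For `k = 3`, `l = 2` and `s = 2` the two-star bound would read `12 ≤ 10`.
  ... | w , v≢w , pv≡pw , g , w∈g = from-no (12 ≤? 10) (stars⇒≤ v≢w pv≡pw star (2-star w∈g))

  -- Let e = {a, b, c}, and let f_b ∋ b and f_c ∋ c be edges other than e. An edge missing both a
  -- and a common vertex of f_b and f_c is a third edge through b or through c.
  tripartite-impossible : s ≡ 2 → r ≢ 3
  tripartite-impossible s≡2 refl
    with in-part first-edge 0F | in-part first-edge 1F | in-part first-edge 2F
  ... | a , a∈e , pa | b , b∈e , pb | c , c∈e , pc
    with other-edge b∈e | other-edge c∈e
  ... | f , e≢f , b∈f | g , e≢g , c∈g
    with intersect f g
  ... | w , w∈f , w∈g
    with missing-edge (⁅ a ⁆ ∪ ⁅ w ⁆) (≤-trans (∣p∪q∣≤∣p∣+∣q∣ ⁅ a ⁆ ⁅ w ⁆)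
           (≤-reflexive (trans (cong₂ _+_ (∣⁅x⁆∣≡1 a) (∣⁅x⁆∣≡1 w)) (sym s≡2))))
  ... | h , miss
    with intersect first-edge h
  ... | z , z∈e , z∈h = by-part (p z) refl
    where
    a∉h : a ∉ E h
    a∉h = miss (x∈p∪q⁺ (inj₁ (x∈⁅x⁆ a)))
    w∉h : w ∉ E h
    w∉h = miss (x∈p∪q⁺ (inj₂ (x∈⁅x⁆ w)))
    e≢h : first-edge ≢ h
    e≢h e≡h = a∉h (subst (_∋ a) e≡h a∈e)
    three : ∀ {x k} → first-edge ∋ x → first-edge ≢ k → k ∋ x → k ∋ w → ¬ h ∋ x
    three {x} {k} x∈e e≢k x∈k w∈k x∈h = no-3-star s≡2
      ( first-edge ∷ᶠ k ∷ᶠ h ∷ᶠ []ᶠ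
      , inj-∷ (∀-∷ {P = first-edge ≢_} e≢k (∀-∷ {P = first-edge ≢_} e≢h (λ ())))
              (inj-pair (λ k≡h → w∉h (subst (_∋ w) k≡h w∈k)))
      , ∀-∷ {P = _∋ x} x∈e (∀-∷ {P = _∋ x} x∈k (∀-∷ {P = _∋ x} x∈h (λ ()))))
    at : ∀ {x j} → first-edge ∋ x → p x ≡ j → p z ≡ j → h ∋ x
    at x∈e px pz = subst (h ∋_) (same-part⇒≡ z∈e x∈e (trans pz (sym px))) z∈h
    -- The part of `z` tells which of `a`, `b`, `c` it is: `h` misses `a`, and the other two would
    -- each carry a star of three edges.
    by-part : ∀ j → p z ≡ j → Absurd
    by-part 0F pz = a∉h (at a∈e pa pz)
    by-part 1F pz = three b∈e e≢f b∈f w∈f (at b∈e pb pz)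
    by-part 2F pz = three c∈e e≢g c∈g w∈g (at c∈e pc pz)

theorem3p6 : (t r : ℕ) → 1 ≤ t → t < r → r ≤ t * t + 3 * t ∸ 1 →
    (n : ℕ) (H : Hypergraph n) →
    Uniform r H → Partite r H → StrictlyIntersecting t H →
    τ≤ H (r ∸ t)
theorem3p6 t r 1≤t t<r r≤ n H uniform partite strict =
  decidable-stable (τ≤? H (r ∸ t)) (impossible t r 1≤t t<r r≤ uniform partite strict)
  where
  -- For `t = 1` the bound reads `r ≤ 3`. If `r = 2`, then `s = 1` and stars of two edges suffice;
  -- `r = 3` is the tripartite case. For `t ≥ 2`, stars of `s + 1` edges give `s + 1 ≤ s`.
  impossible : ∀ t r → 1 ≤ t → t < r → r ≤ t * t + 3 * t ∸ 1 →
    Uniform r H → Partite r H → StrictlyIntersecting t H → ¬ ¬ τ≤ H (r ∸ t)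
  impossible 1 1 _ (s≤s ()) _ _ _ _ _
  impossible 1 2 _ _ _ uniform partite strict ¬τ≤ =
    n≮n 1 (stars-everywhere⇒≤ H refl ≤-refl ≤-refl uniform partite strict ¬τ≤ 2
            (2-star H refl ≤-refl ≤-refl uniform partite strict ¬τ≤))
  impossible 1 3 _ _ _ uniform partite strict ¬τ≤ =
    tripartite-impossible H refl (s≤s z≤n) ≤-refl uniform partite strict ¬τ≤ refl refl
  impossible 1 (suc (suc (suc (suc _)))) _ _ (s≤s (s≤s (s≤s ()))) _ _ _ _
  impossible t@(suc (suc _)) r 1≤t t<r _ uniform partite strict ¬τ≤ =
    n≮n (r ∸ t) (stars-everywhere⇒≤ H r≡s+t 1≤s 1≤t uniform partite strict ¬τ≤ (suc (r ∸ t))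
      ([1+s]-star H r≡s+t 1≤s 1≤t uniform partite strict ¬τ≤ (s≤s (s≤s z≤n))))
    where
    r≡s+t : r ≡ r ∸ t + t
    r≡s+t = sym (m∸n+n≡m (<⇒≤ t<r))
    1≤s : 1 ≤ r ∸ t
    1≤s = m<n⇒0<n∸m t<r
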